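{- Let $R=(r_1,\dots,r_n)$ and $S=(s_1,\dots,s_n)$ be vectors of real numbers with $\sum_i r_i=\sum_j s_j$. Then $\mathcal{T}^{\times}(R,S)\neq\emptyset$ if and only if (a) $R=S$, and (b) $R$ is palindromic, i.e. $r_i=r_{n+1-i}$ for all $i$. The same is true for $\mathcal{T}^{\times}_{\mathbb{Z}}(R,S)$: if $R$ and $S$ have nonnegative integer components, then $\mathcal{T}^{\times}_{\mathbb{Z}}(R,S)\neq\emptyset$ if and only if (a) and (b) hold.
   Context: $\mathcal{T}(R,S)$ is the set of $n\times n$ matrices with nonnegative real entries whose $i$th row sum is $r_i$ and whose $j$th column sum is $s_j$ for all $i,j$. The group $D_\times=\{\rho_0,\rho_\pi,r_{+1},r_{ -1}\}$ acts on $n\times n$ matrices, where $\rho_0$ is the identity, $(\rho_\pi A)_{i,j}=a_{n+1-i,\,n+1-j}$ (rotation by $\pi$), $(r_{ -1}A)_{i,j}=a_{j,i}$ (transposition), and $(r_{+1}A)_{i,j}=a_{n+1-j,\,n+1-i}$ (transposition with respect to the antidiagonal). $\mathcal{T}^{\times}(R,S)$ is the set of $A\in\mathcal{T}(R,S)$ fixed by every element of $D_\times$; $\mathcal{T}^{\times}_{\mathbb{Z}}(R,S)$ is the set of those $A\in\mathcal{T}^{\times}(R,S)$ all of whose entries are integers.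
   Formalization: The vectors R and S are assumed to have nonnegative entries; without this the "if" direction fails, e.g. n = 1, R = S = (−1) satisfies (a) and (b) although 𝒯(R,S) is empty. -}

module Defs where

open import Algebra.Bundles using (CommutativeMonoid)
open import Data.Fin.Base using (Fin; opposite)
open import Data.Integer.Base as ℤ using (ℤ)
open import Data.Nat.Base as ℕ using (ℕ)
import Data.Nat.Properties as ℕ
open import Data.Product.Base using (∃-syntax; _×_; _,_)
open import Data.Rational.Base as ℚ using (ℚ; 0ℚ; ½; ∣_∣)
import Data.Rational.Properties as ℚ
open import Data.Rational.Solver using (module +-*-Solver)
open import Data.Vec.Functional using (Vector)
open import Level using (0ℓ)
open import Relation.Binary.PropositionalEquality
  using (_≡_; refl; sym; trans; cong; subst)
open import Relation.Unary using (Pred; _∩_)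

------------------------------------------------------------------------
-- Real numbers: Cauchy sequences of rationals, with the setoid equality
-- "the difference tends to 0".

record ℝ : Set where
  no-eta-equality
  constructor mkℝ
  field
    seq    : ℕ → ℚ
    cauchy : ∀ ε → 0ℚ ℚ.< ε →
             ∃[ N ] (∀ m n → N ℕ.≤ m → N ℕ.≤ n → ∣ seq m ℚ.- seq n ∣ ℚ.< ε)

open ℝ public

infix 4 _≈_ _≤_
infixl 6 _+_

-- Records rather than functions, so that x and y can be inferred from x ≈ y.
record _≈_ (x y : ℝ) : Set where
  constructor mk≈
  field
    close : ∀ ε → 0ℚ ℚ.< ε →
            ∃[ N ] (∀ n → N ℕ.≤ n → ∣ seq x n ℚ.- seq y n ∣ ℚ.< ε)

record _≤_ (x y : ℝ) : Set where
  constructor mk≤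
  field
    bound : ∀ ε → 0ℚ ℚ.< ε →
            ∃[ N ] (∀ n → N ℕ.≤ n → seq x n ℚ.< seq y n ℚ.+ ε)

open _≈_ public
open _≤_ public

-- Abstract, so that comparing reals never unfolds the proofs they carry.
private abstract
  0<½*_ : ∀ {ε} → 0ℚ ℚ.< ε → 0ℚ ℚ.< ½ ℚ.* ε
  0<½*_ 0<ε = ℚ.*-monoʳ-<-pos ½ 0<ε

  ∣p+q∣<ε : ∀ ε p q → ∣ p ∣ ℚ.< ½ ℚ.* ε → ∣ q ∣ ℚ.< ½ ℚ.* ε → ∣ p ℚ.+ q ∣ ℚ.< ε
  ∣p+q∣<ε ε p q p< q< = ℚ.≤-<-trans (ℚ.∣p+q∣≤∣p∣+∣q∣ p q)
    (subst (∣ p ∣ ℚ.+ ∣ q ∣ ℚ.<_) halves (ℚ.+-mono-< p< q<))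
    where
    halves : ½ ℚ.* ε ℚ.+ ½ ℚ.* ε ≡ ε
    halves = trans (sym (ℚ.*-distribʳ-+ ε ½ ½)) (ℚ.*-identityˡ ε)

  interchange : ∀ a b c d → (a ℚ.- c) ℚ.+ (b ℚ.- d) ≡ (a ℚ.+ b) ℚ.- (c ℚ.+ d)
  interchange = solve 4
    (λ a b c d → (a :- c) :+ (b :- d) := (a :+ b) :- (c :+ d)) refl
    where open +-*-Solver

  telescope : ∀ a b c → (a ℚ.- b) ℚ.+ (b ℚ.- c) ≡ a ℚ.- c
  telescope = solve 3 (λ a b c → (a :- b) :+ (b :- c) := a :- c) refl
    where open +-*-Solver

  negate : ∀ a b → ℚ.- (a ℚ.- b) ≡ b ℚ.- a
  negate = solve 2 (λ a b → :- (a :- b) := b :- a) refl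
    where open +-*-Solver

  ∣p-p∣<ε : ∀ {ε} p → 0ℚ ℚ.< ε → ∣ p ℚ.- p ∣ ℚ.< ε
  ∣p-p∣<ε {ε} p = subst (λ q → ∣ q ∣ ℚ.< ε) (sym (ℚ.+-inverseʳ p))

fromℚ : ℚ → ℝ
fromℚ q = mkℝ (λ _ → q) λ _ 0<ε → 0 , λ _ _ _ _ → ∣p-p∣<ε q 0<ε

0ℝ : ℝ
0ℝ = fromℚ 0ℚ

fromℤ : ℤ → ℝ
fromℤ z = fromℚ (z ℚ./ 1)

_+_ : ℝ → ℝ → ℝ
(x + y) .seq n = seq x n ℚ.+ seq y n
(x + y) .cauchy ε 0<ε =
  let M , x< = cauchy x (½ ℚ.* ε) (0<½* 0<ε)
      N , y< = cauchy y (½ ℚ.* ε) (0<½* 0<ε)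
  in M ℕ.⊔ N , λ m n ≤m ≤n →
    subst (λ q → ∣ q ∣ ℚ.< ε) (interchange (seq x m) (seq y m) (seq x n) (seq y n))
      (∣p+q∣<ε ε _ _
        (x< m n (ℕ.m⊔n≤o⇒m≤o M N ≤m) (ℕ.m⊔n≤o⇒m≤o M N ≤n))
        (y< m n (ℕ.m⊔n≤o⇒n≤o M N ≤m) (ℕ.m⊔n≤o⇒n≤o M N ≤n)))

≗⇒≈ : ∀ {x y} → (∀ n → seq x n ≡ seq y n) → x ≈ y
≗⇒≈ {x} {y} x≗y = mk≈ λ ε 0<ε → 0 , λ n _ →
  subst (λ q → ∣ q ℚ.- seq y n ∣ ℚ.< ε) (sym (x≗y n)) (∣p-p∣<ε (seq y n) 0<ε)

≈-sym : ∀ {x y} → x ≈ y → y ≈ x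
≈-sym {x} {y} x≈y = mk≈ λ ε 0<ε →
  let N , x< = close x≈y ε 0<ε
  in N , λ n ≤n →
    subst (ℚ._< ε)
      (trans (sym (ℚ.∣-p∣≡∣p∣ (seq x n ℚ.- seq y n)))
             (cong ∣_∣ (negate (seq x n) (seq y n))))
      (x< n ≤n)

≈-trans : ∀ {x y z} → x ≈ y → y ≈ z → x ≈ z
≈-trans {x} {y} {z} x≈y y≈z = mk≈ λ ε 0<ε →
  let M , p< = close x≈y (½ ℚ.* ε) (0<½* 0<ε)
      N , q< = close y≈z (½ ℚ.* ε) (0<½* 0<ε)
  in M ℕ.⊔ N , λ n ≤n →
    subst (λ q → ∣ q ∣ ℚ.< ε) (telescope (seq x n) (seq y n) (seq z n))
      (∣p+q∣<ε ε _ _ (p< n (ℕ.m⊔n≤o⇒m≤o M N ≤n)) (q< n (ℕ.m⊔n≤o⇒n≤o M N ≤n)))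

+-cong : ∀ {x y u v} → x ≈ y → u ≈ v → x + u ≈ y + v
+-cong {x} {y} {u} {v} x≈y u≈v = mk≈ λ ε 0<ε →
  let M , p< = close x≈y (½ ℚ.* ε) (0<½* 0<ε)
      N , q< = close u≈v (½ ℚ.* ε) (0<½* 0<ε)
  in M ℕ.⊔ N , λ n ≤n →
    subst (λ q → ∣ q ∣ ℚ.< ε) (interchange (seq x n) (seq u n) (seq y n) (seq v n))
      (∣p+q∣<ε ε _ _ (p< n (ℕ.m⊔n≤o⇒m≤o M N ≤n)) (q< n (ℕ.m⊔n≤o⇒n≤o M N ≤n)))

+-0-commutativeMonoid : CommutativeMonoid 0ℓ 0ℓ
+-0-commutativeMonoid = record
  { Carrier = ℝ
  ; _≈_     = _≈_
  ; _∙_     = _+_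
  ; ε       = 0ℝ
  ; isCommutativeMonoid = record
    { isMonoid = record
      { isSemigroup = record
        { isMagma = record
          { isEquivalence = record
            { refl  = ≗⇒≈ λ _ → refl
            ; sym   = ≈-sym
            ; trans = ≈-trans
            }
          ; ∙-cong = +-cong
          }
        ; assoc = λ x y z → ≗⇒≈ λ n → ℚ.+-assoc (seq x n) (seq y n) (seq z n)
        }
      ; identity = (λ x → ≗⇒≈ λ n → ℚ.+-identityˡ (seq x n))
                 , (λ x → ≗⇒≈ λ n → ℚ.+-identityʳ (seq x n))
      }
    ; comm = λ x y → ≗⇒≈ λ n → ℚ.+-comm (seq x n) (seq y n)
    }
  }

open import Algebra.Properties.CommutativeMonoid.Sum +-0-commutativeMonoid public
  using (sum)

IsInteger : Pred ℝ 0ℓ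
IsInteger x = ∃[ z ] (x ≈ fromℤ z)

------------------------------------------------------------------------
-- Vectors and matrices

infix 4 _≋_

_≋_ : ∀ {n} → Vector ℝ n → Vector ℝ n → Set
R ≋ S = ∀ i → R i ≈ S i

NonNegative : ∀ {n} → Pred (Vector ℝ n) 0ℓ
NonNegative R = ∀ i → 0ℝ ≤ R i

Integral : ∀ {n} → Pred (Vector ℝ n) 0ℓ
Integral R = ∀ i → IsInteger (R i)

-- With 0-based indices, i ↦ n+1-i is `opposite`.
Palindromic : ∀ {n} → Pred (Vector ℝ n) 0ℓ
Palindromic R = ∀ i → R i ≈ R (opposite i)

Matrix : ℕ → Set
Matrix n = Fin n → Fin n → ℝ

record 𝒯 {n} (R S : Vector ℝ n) (A : Matrix n) : Set where
  field
    nonNegative : ∀ i j → 0ℝ ≤ A i j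
    rowSum      : ∀ i → sum (λ j → A i j) ≈ R i
    colSum      : ∀ j → sum (λ i → A i j) ≈ S j

------------------------------------------------------------------------
-- The group D× and its action

data D× : Set where
  ρ₀ ρπ r₊₁ r₋₁ : D×

infixr 7 _·_

_·_ : ∀ {n} → D× → Matrix n → Matrix n
(ρ₀  · A) i j = A i j
(ρπ  · A) i j = A (opposite i) (opposite j)
(r₊₁ · A) i j = A (opposite j) (opposite i)
(r₋₁ · A) i j = A j i

Fixed : ∀ {n} → Pred (Matrix n) 0ℓ
Fixed A = ∀ g i j → (g · A) i j ≈ A i j

𝒯× : ∀ {n} → Vector ℝ n → Vector ℝ n → Pred (Matrix n) 0ℓ
𝒯× R S = 𝒯 R S ∩ Fixed

𝒯×ℤ : ∀ {n} → Vector ℝ n → Vector ℝ n → Pred (Matrix n) 0ℓ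
𝒯×ℤ R S = 𝒯× R S ∩ λ A → ∀ i j → IsInteger (A i j)

{-# OPTIONS --safe #-}
-- Transposition invariance equates the i-th row sum with the i-th column sum,
-- and rotation invariance the i-th row sum with that of the opposite row.
-- Conversely, the diagonal matrix with diagonal R is invariant under
-- transposition, and palindromicity of R makes it invariant under rotation.
module Submission where

open import Defs
open import Algebra.Bundles using (CommutativeMonoid)
open import Algebra.Properties.CommutativeMonoid.Sum +-0-commutativeMonoid
  using (sum-cong-≋; sum-permute; sum-remove; sum-replicate-zero)
open import Data.Fin.Base using (Fin; opposite; punchIn)
open import Data.Fin.Permutation using (reverse)
open import Data.Fin.Properties using (_≟_; opposite-involutive; punchInᵢ≢i)
open import Data.Integer.Base using (0ℤ)
open import Data.Nat.Base using (ℕ; suc)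
open import Data.Product.Base using (_×_; _,_)
import Data.Rational.Base as ℚ
import Data.Rational.Properties as ℚ
open import Data.Vec.Functional using (Vector; removeAt)
open import Function.Base using (_∘_)
open import Function.Bundles using (_⇔_; mk⇔)
open import Relation.Binary.PropositionalEquality as ≡ using (_≡_; _≢_; subst)
open import Relation.Nullary.Decidable using (yes; no)
open import Relation.Nullary.Negation using (contradiction)
open import Relation.Unary using (Satisfiable)

open CommutativeMonoid +-0-commutativeMonoid
  using (setoid; reflexive; identityʳ; ∙-congˡ) renaming (refl to ≈-refl)
open import Relation.Binary.Reasoning.Setoid setoid

private
  variable
    n : ℕ
    R S : Vector ℝ n
    A : Matrix n

≤-refl : ∀ {x} → x ≤ x
≤-refl {x} = mk≤ λ ε 0<ε → 0 , λ n _ →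
  subst (ℚ._< seq x n ℚ.+ ε) (ℚ.+-identityʳ (seq x n)) (ℚ.+-monoʳ-< (seq x n) 0<ε)

sum-zero : {t : Vector ℝ n} → (∀ i → t i ≈ 0ℝ) → sum t ≈ 0ℝ
sum-zero {n} t≈0 = ≈-trans (sum-cong-≋ t≈0) (sum-replicate-zero n)

-- Splitting off index `i` leaves a sum of zeros. This evaluates the rows of a diagonal matrix.
sum-single : (t : Vector ℝ n) (i : Fin n) → (∀ j → j ≢ i → t j ≈ 0ℝ) → sum t ≈ t i
sum-single {suc n} t i t≈0 = begin
  sum t                     ≈⟨ sum-remove {i = i} t ⟩
  t i + sum (removeAt t i)  ≈⟨ ∙-congˡ (sum-zero λ j → t≈0 (punchIn i j) (punchInᵢ≢i i j)) ⟩
  t i + 0ℝ                  ≈⟨ identityʳ (t i) ⟩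
  t i                       ∎

opposite-injective : {i j : Fin n} → opposite i ≡ opposite j → i ≡ j
opposite-injective {i = i} {j} eq =
  ≡.trans (≡.sym (opposite-involutive i)) (≡.trans (≡.cong opposite eq) (opposite-involutive j))

𝒯×⇒R≋S : 𝒯× R S A → R ≋ S
𝒯×⇒R≋S {R = R} {S} {A} (A∈𝒯 , fixed) i = begin
  R i                ≈⟨ rowSum i ⟨
  -- Transposition invariance turns row `i` into column `i` entry by entry.
  sum (λ j → A i j)  ≈⟨ sum-cong-≋ (λ j → fixed r₋₁ j i) ⟩
  sum (λ j → A j i)  ≈⟨ colSum i ⟩
  S i                ∎
  where open 𝒯 A∈𝒯

𝒯×⇒palindromic : 𝒯× R S A → Palindromic R
𝒯×⇒palindromic {R = R} {S} {A} (A∈𝒯 , fixed) i = begin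
  R i                                     ≈⟨ rowSum i ⟨
  sum (λ j → A i j)                       ≈⟨ sum-cong-≋ (λ j → fixed ρπ i j) ⟨
  -- Rotation yields the opposite row read backwards; reversing the summation index restores its
  -- order.
  sum (λ j → A (opposite i) (opposite j)) ≈⟨ sum-permute (A (opposite i)) reverse ⟨
  sum (λ j → A (opposite i) j)            ≈⟨ rowSum (opposite i) ⟩
  R (opposite i)                          ∎
  where open 𝒯 A∈𝒯

diagonal : Vector ℝ n → Matrix n
diagonal R i j with i ≟ j
... | yes _ = R i
... | no  _ = 0ℝ

-- Together with `diagonal-≢`, this evaluates entries at transposed or rotated positions, where a
-- case split on `i ≟ j` alone does not reduce `diagonal`.
diagonal-≡ : (R : Vector ℝ n) {i j : Fin n} → i ≡ j → diagonal R i j ≈ R i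
diagonal-≡ R {i} {j} i≡j with i ≟ j
... | yes _   = ≈-refl
... | no  i≢j = contradiction i≡j i≢j

diagonal-≢ : (R : Vector ℝ n) {i j : Fin n} → i ≢ j → diagonal R i j ≈ 0ℝ
diagonal-≢ R {i} {j} i≢j with i ≟ j
... | yes i≡j = contradiction i≡j i≢j
... | no  _   = ≈-refl

diagonal-nonNegative : NonNegative R → ∀ i j → 0ℝ ≤ diagonal R i j
diagonal-nonNegative R≥0 i j with i ≟ j
... | yes _ = R≥0 i
... | no  _ = ≤-refl

diagonal-integral : Integral R → ∀ i j → IsInteger (diagonal R i j)
diagonal-integral R∈ℤ i j with i ≟ j
... | yes _ = R∈ℤ i
... | no  _ = 0ℤ , ≈-refl

diagonal-sym : (R : Vector ℝ n) (i j : Fin n) → diagonal R j i ≈ diagonal R i j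
diagonal-sym R i j with i ≟ j
... | yes i≡j = ≈-trans (diagonal-≡ R (≡.sym i≡j)) (reflexive (≡.cong R (≡.sym i≡j)))
... | no  i≢j = diagonal-≢ R (i≢j ∘ ≡.sym)

-- Since `opposite` is injective, rotation maps the diagonal to itself and its complement to itself.
-- On the diagonal it replaces `R i` by `R (opposite i)`.
diagonal-opposite : Palindromic R →
                    ∀ i j → diagonal R (opposite i) (opposite j) ≈ diagonal R i j
diagonal-opposite {R = R} pal i j with i ≟ j
... | yes i≡j = ≈-trans (diagonal-≡ R (≡.cong opposite i≡j)) (≈-sym (pal i))
... | no  i≢j = diagonal-≢ R (i≢j ∘ opposite-injective)

diagonal-fixed : Palindromic R → Fixed (diagonal R)
diagonal-fixed pal ρ₀  i j = ≈-refl
diagonal-fixed pal ρπ  i j = diagonal-opposite pal i j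
diagonal-fixed {R = R} pal r₊₁ i j =
  -- The antidiagonal reflection is the composite of rotation and transposition.
  ≈-trans (diagonal-opposite pal j i) (diagonal-sym R i j)
diagonal-fixed {R = R} pal r₋₁ i j = diagonal-sym R i j

diagonal-rowSum : (R : Vector ℝ n) (i : Fin n) → sum (λ j → diagonal R i j) ≈ R i
diagonal-rowSum R i =
  ≈-trans (sum-single (diagonal R i) i (λ j j≢i → diagonal-≢ R (j≢i ∘ ≡.sym)))
          (diagonal-≡ R ≡.refl)

diagonal-colSum : (R : Vector ℝ n) (j : Fin n) → sum (λ i → diagonal R i j) ≈ R j
diagonal-colSum R j =
  ≈-trans (sum-cong-≋ (λ i → diagonal-sym R j i)) (diagonal-rowSum R j)

-- Both row and column sums of the diagonal matrix are `R`; `R ≋ S` turns the latter into `S`.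
diagonal∈𝒯× : NonNegative R → R ≋ S → Palindromic R → 𝒯× R S (diagonal R)
diagonal∈𝒯× {R = R} R≥0 R≋S pal = record
  { nonNegative = diagonal-nonNegative R≥0
  ; rowSum      = diagonal-rowSum R
  ; colSum      = λ j → ≈-trans (diagonal-colSum R j) (R≋S j)
  } , diagonal-fixed pal

theorem5 : ∀ (n : ℕ) (R S : Vector ℝ n) →
    NonNegative R → NonNegative S → sum R ≈ sum S →
    (Satisfiable (𝒯× R S) ⇔ (R ≋ S × Palindromic R))
    × (Integral R → Integral S →
    (Satisfiable (𝒯×ℤ R S) ⇔ (R ≋ S × Palindromic R)))
theorem5 n R S R≥0 _ _ =
    mk⇔ (λ (_ , A∈𝒯×) → necessary A∈𝒯×) (λ (R≋S , pal) → diagonal R , diagonal∈𝒯× R≥0 R≋S pal)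
  , λ R∈ℤ _ →
    -- Necessity is inherited from the real case. The same witness serves for sufficiency, its
    -- entries being components of `R` or zero.
    mk⇔ (λ (_ , A∈𝒯× , _) → necessary A∈𝒯×)
        (λ (R≋S , pal) → diagonal R , diagonal∈𝒯× R≥0 R≋S pal , diagonal-integral R∈ℤ)
  where
  necessary : ∀ {A} → 𝒯× R S A → R ≋ S × Palindromic R
  necessary A∈𝒯× = 𝒯×⇒R≋S A∈𝒯× , 𝒯×⇒palindromic A∈𝒯×
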